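{- Let $F$ be an oriented star of degree at least $5$, and let $H$ be a digraph. If $\{H, F\}$ is $\vec{\chi}$-finite, then $H$ is a transitive tournament.
   Context: All digraphs are finite, loopless, and between any two distinct vertices $u,v$ at most one of the arcs $uv$, $vu$ is present. A digraph $D$ is $H$-free if no induced subdigraph of $D$ is isomorphic to $H$, and $\mathcal{F}$-free if it is $H$-free for every $H \in \mathcal{F}$. A $k$-dicolouring of $D$ is a map $f: V(D) \to \{1,\dots,k\}$ such that each colour class induces an acyclic subdigraph (contains no directed cycle); the dichromatic number $\vec{\chi}(D)$ is the least $k$ for which a $k$-dicolouring exists. A finite family $\mathcal{F}$ of digraphs is $\vec{\chi}$-finite if there is a constant $c$ such that every $\mathcal{F}$-free digraph has dichromatic number at most $c$. An oriented star of degree $t$ is an orientation of the complete bipartite graph $K_{1,t}$. A tournament is an orientation of a complete graph; it is transitive if it is acyclic. -}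

module Defs where

open import Data.Nat using (ℕ; zero; suc; _+_; _≤_)
open import Data.Fin using (Fin; zero; suc; toℕ; _≟_)
open import Data.Bool using (Bool; true; false)
open import Data.Product using (Σ; ∃; _×_; _,_)
open import Data.Sum using (_⊎_)
open import Data.Empty using (⊥)
open import Relation.Nullary using (¬_)
open import Relation.Binary.PropositionalEquality using (_≡_; _≢_)
open import Function.Definitions using (Injective)

record Digraph : Set where
  field
    n        : ℕ
    arc      : Fin n → Fin n → Bool
    loopless : ∀ v → arc v v ≡ false
    oriented : ∀ u v → arc u v ≡ true → arc v u ≡ false
open Digraph public

next : ∀ {m} → Fin (suc m) → Fin (suc m)
next {zero}  zero          = zero
next {suc m} zero          = suc zero
next {suc m} (suc i) with next {m} i
... | zero  = zero
... | suc j = suc (suc j)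

record DirectedCycle (D : Digraph) (k : ℕ) : Set where
  field
    vert   : Fin (suc (suc k)) → Fin (n D)
    inj    : Injective _≡_ _≡_ vert
    arcs   : ∀ i → arc D (vert i) (vert (next i)) ≡ true
open DirectedCycle public

Acyclic : Digraph → Set
Acyclic D = ∀ k → ¬ DirectedCycle D k

record InducedCopy (H D : Digraph) : Set where
  field
    emb    : Fin (n H) → Fin (n D)
    injEmb : Injective _≡_ _≡_ emb
    pres   : ∀ u v → arc D (emb u) (emb v) ≡ arc H u v
open InducedCopy public

Free : Digraph → Digraph → Set
Free H D = ¬ InducedCopy H D

IsDicolouring : (D : Digraph) (k : ℕ) → (Fin (n D) → Fin k) → Set
IsDicolouring D k f =
  ∀ m (C : DirectedCycle D m) → ¬ (∀ i → f (vert C i) ≡ f (vert C zero))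

Dicolourable : Digraph → ℕ → Set
Dicolourable D k = Σ (Fin (n D) → Fin k) (IsDicolouring D k)

-- {H , F} is χ⃗-finite: some constant c bounds the dichromatic number of
-- every {H , F}-free digraph (dichromatic number ≤ c iff c-dicolourable).
ChiFinite₂ : Digraph → Digraph → Set
ChiFinite₂ H F = ∃ λ c → ∀ D → Free H D → Free F D → Dicolourable D c

Adjacent : (D : Digraph) → Fin (n D) → Fin (n D) → Set
Adjacent D u v = (arc D u v ≡ true) ⊎ (arc D v u ≡ true)

record IsOrientedStar (F : Digraph) (t : ℕ) : Set where
  field
    size      : n F ≡ suc t
    centre    : Fin (n F)
    spokes    : ∀ v → v ≢ centre → Adjacent F centre v
    noLeafArc : ∀ u v → u ≢ centre → v ≢ centre → arc F u v ≡ false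

-- Tournament: every two distinct vertices are adjacent; transitive = acyclic.
IsTournament : Digraph → Set
IsTournament D = ∀ u v → u ≢ v → Adjacent D u v

IsTransitiveTournament : Digraph → Set
IsTransitiveTournament D = IsTournament D × Acyclic D

{-# OPTIONS --safe #-}
module Submission where

-- If H is not a tournament, every tournament is {H, F}-free; if H is a tournament with a directed
-- cycle, it contains a directed triangle.  So it suffices to find digraphs without directed
-- triangles, with K_{1,5}-free underlying graph and large dichromatic number: completing them to tournaments
-- handles the first case.  Take the points of {0,…,N−1}⁴, with an arc from x to y when
-- y = x + t (e_{i+1} − e_i) for some t > 0 and some direction i, indices modulo 4.
-- The neighbours of x in a given direction form a clique with x, so 4 cliques cover the neighbourhood.
-- The only linear relation between the four directions is that their sum vanishes, so a closed walk
-- uses all of them and has length at least 4.  Counting letters maps a combinatorial line over a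
-- 4-letter alphabet to points x + t e₀, …, x + t e₃, a directed 4-cycle, and Hales–Jewett provides
-- a monochromatic one.

open import Defs
open import Data.Bool using (true; false; not; _∧_; _∨_; if_then_else_)
import Data.Bool as Bool
open import Data.Empty using (⊥; ⊥-elim)
open import Data.Fin using (Fin; zero; suc; toℕ; fromℕ; fromℕ<; inject₁; combine; punchIn; finToFun; funToFin; _≟_; _<?_)
open import Data.Fin.Induction using (<-weakInduction)
open import Data.Fin.Properties using (toℕ-fromℕ<; toℕ<n; toℕ-injective; <⇒notInjective; finToFun-funToFin; funToFin-finToFin; pigeonhole; punchInᵢ≢i; punchIn-injective; all?; any?; <-irrefl; <-asym; <-cmp; <⇒≢)
open import Data.Maybe using (Maybe; just; nothing; fromMaybe)
open import Data.Nat using (ℕ; zero; suc; _+_; _*_; _∸_; _^_; _≤_; _<_; s≤s; z≤n; z<s)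
import Data.Nat.Properties as ℕ
open import Data.Nat.Tactic.RingSolver using (solve-∀)
open import Data.Product using (∃; _×_; _,_; proj₁; proj₂)
open import Data.Sum using (_⊎_; inj₁; inj₂; [_,_]′)
open import Data.Vec using (Vec; []; _∷_; _++_; map; tabulate; lookup)
open import Data.Vec.Membership.Propositional using (_∈_)
open import Data.Vec.Membership.Propositional.Properties using (∈-++⁺ˡ; ∈-++⁺ʳ)
open import Data.Vec.Properties using (map-++; map-∘; map-id; tabulate∘lookup; tabulate-cong)
open import Data.Vec.Relation.Unary.Any using (here; there)
open import Function using (_∘_; id)
open import Function.Definitions using (Injective)
open import Relation.Binary.Definitions using (tri<; tri≈; tri>)
open import Relation.Binary.PropositionalEquality hiding ([_])
open import Relation.Nullary using (¬_; Dec; yes; no; does; contradiction)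
open import Relation.Nullary.Decidable using (_⊎-dec_; dec-true; dec-false; ¬?; _×-dec_; _→-dec_; map′; from-yes)

-- The Hales–Jewett theorem

-- In a pattern, `nothing` marks the wildcard positions, all of which receive the same letter.
Word Pattern : ℕ → ℕ → Set
Word r l    = Vec (Fin r) l
Pattern r l = Vec (Maybe (Fin r)) l

_[_] : ∀ {r l} → Pattern r l → Fin r → Word r l
τ [ i ] = map (fromMaybe i) τ

constant : ∀ {r l} → Word r l → Pattern r l
constant = map just

constant-[] : ∀ {r l} (w : Word r l) i → constant w [ i ] ≡ w
constant-[] w i = trans (sym (map-∘ (fromMaybe i) just w)) (map-id w)

++-[] : ∀ {r l m} (σ : Pattern r l) (τ : Pattern r m) i → (σ ++ τ) [ i ] ≡ σ [ i ] ++ τ [ i ]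
++-[] σ τ i = map-++ (fromMaybe i) σ τ

module _ {r : ℕ} where

  Line : ℕ → Set
  Line l = ∃ λ (τ : Pattern (suc r) l) → nothing ∈ τ

  -- Only the letters below `j` are constrained, which allows induction on `j`; at `j = suc r` the
  -- whole line is covered.
  Mono : ∀ {l k} → ℕ → (Word (suc r) l → Fin k) → Pattern (suc r) l → Fin k → Set
  Mono j f τ c = ∀ i → toℕ i < j → f (τ [ i ]) ≡ c

  MonoLine : ∀ {l k} → ℕ → (Word (suc r) l → Fin k) → Set
  MonoLine {l} j f = ∃ λ ((τ , _) : Line l) → Mono j f τ (f (τ [ zero ]))

  -- The lines have pairwise distinct colours on the letters below `focus` and all meet in `point`
  -- at the letter `focus`. Distinctness forces `s ≤ k`.
  record Focused {l k} (s : ℕ) (focus : Fin (suc r)) (f : Word (suc r) l → Fin k) : Set where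
    field
      point      : Word (suc r) l
      colour     : Fin s → Fin k
      colour-inj : Injective _≡_ _≡_ colour
      line       : Fin s → Line l
      line-mono  : ∀ a → Mono (toℕ focus) f (proj₁ (line a)) (colour a)
      line-focus : ∀ a → proj₁ (line a) [ focus ] ≡ point
  open Focused

  HalesJewettBelow : ℕ → ℕ → Set
  HalesJewettBelow j k = ∃ λ l → (f : Word (suc r) l → Fin k) → MonoLine j f

  decode : ∀ {l} → Fin (suc r ^ l) → Word (suc r) l
  decode = tabulate ∘ finToFun

  decode-surjective : ∀ {l} (w : Word (suc r) l) → ∃ λ a → decode a ≡ w
  decode-surjective w = funToFin (lookup w) ,
    trans (tabulate-cong (finToFun-funToFin (lookup w))) (tabulate∘lookup w)

  module _ {l m k} (f : Word (suc r) (m + l) → Fin k) where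

    -- The colour of a prefix `u` is the entire function sending `w` to `f (u ++ w)`, coded as a
    -- number.
    suffixColouring : Word (suc r) m → Fin (k ^ (suc r ^ l))
    suffixColouring u = funToFin (λ a → f (u ++ decode a))

    suffixColouring-≡ : ∀ {u v} → suffixColouring u ≡ suffixColouring v →
                        ∀ w → f (u ++ w) ≡ f (v ++ w)
    suffixColouring-≡ {u} {v} eq w with a , refl ← decode-surjective w =
      trans (sym (finToFun-funToFin (λ a → f (u ++ decode a)) a))
     (trans (cong (λ g → finToFun g a) eq)
            (finToFun-funToFin (λ a → f (v ++ decode a)) a))

  snoc : ∀ {s} {A : Set} → A → (Fin s → A) → Fin (suc s) → A
  snoc x g zero    = x
  snoc x g (suc a) = g a

  mono-extend : ∀ {l k} {f : Word (suc r) l → Fin k} {c} (i : Fin (suc r)) ((τ , τ∋) : Line l) →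
                Mono (toℕ i) f τ c → f (τ [ i ]) ≡ c → MonoLine (suc (toℕ i)) f
  mono-extend {f = f} {c} i (τ , τ∋) mono eq =
    -- The letter `zero` is always in range, so `c` agrees with the colour at `zero` that `MonoLine`
    -- refers to.
    (τ , τ∋) , λ i′ i′≤i → trans (mono′ i′ i′≤i) (sym (mono′ zero (s≤s z≤n)))
    where
    mono′ : Mono (suc (toℕ i)) f τ c
    mono′ i′ (s≤s i′≤i) with ℕ.m≤n⇒m<n∨m≡n i′≤i
    ... | inj₁ i′<i = mono i′ i′<i
    ... | inj₂ i′≡i rewrite toℕ-injective i′≡i = eq

  MonoOrFocused : ∀ {l k} → ℕ → Fin (suc r) → (Word (suc r) l → Fin k) → Set
  MonoOrFocused s i f = MonoLine (suc (toℕ i)) f ⊎ Focused s i f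

  prepend : ∀ {l m k j} (f : Word (suc r) (m + l) → Fin k) (u : Word (suc r) m) →
            MonoLine {l} j (λ w → f (u ++ w)) → MonoLine j f
  prepend {l} {m} f u ((τ , τ∋) , mono) = (constant u ++ τ , ∈-++⁺ʳ (constant u) τ∋) , λ i i< →
      trans (cong f (eval i)) (trans (mono i i<) (cong f (sym (eval zero))))
    where
    eval : ∀ i → (constant u ++ τ) [ i ] ≡ u ++ τ [ i ]
    eval i = trans (++-[] (constant u) τ i) (cong (_++ τ [ i ]) (constant-[] u i))

  -- Colour focusing: f cannot distinguish the words σ [ i′ ], i′ < i, as prefixes, so either the colour of
  -- the focus completes a focused line, or the focus itself, moved along σ, is a line of a new colour.
  refocus : ∀ {l m k s} i (f : Word (suc r) (m + l) → Fin k) ((σ , _) : Line m) →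
            Mono (toℕ i) (suffixColouring f) σ (suffixColouring f (σ [ zero ])) →
            Focused s i (λ w → f (σ [ zero ] ++ w)) → MonoOrFocused (suc s) i f
  refocus {l} {m} {k} {s} i f (σ , σ∋) mono F
    with any? (λ a → f (σ [ zero ] ++ point F) ≟ colour F a)
  ... | yes (a , eq) = inj₁ (prepend f (σ [ zero ])
          (mono-extend {f = λ w → f (σ [ zero ] ++ w)} i (line F a) (line-mono F a)
          (trans (cong (λ w → f (σ [ zero ] ++ w)) (line-focus F a)) eq)))
  ... | no new = inj₂ record
    { point      = σ [ i ] ++ point F
    ; colour     = colour′
    ; colour-inj = λ {a} {b} → inj′ a b
    ; line       = λ a → σ ++ tail a , ∈-++⁺ˡ σ∋
    ; line-mono  = λ a i′ i′< → trans (cong f (++-[] σ (tail a) i′))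
        (trans (suffixColouring-≡ f (mono i′ i′<) (tail a [ i′ ])) (tail-mono a i′ i′<))
    ; line-focus = λ a → trans (++-[] σ (tail a) i) (cong (σ [ i ] ++_) (tail-focus a))
    }
    where
    colour′ : Fin (suc s) → Fin k
    colour′ = snoc (f (σ [ zero ] ++ point F)) (colour F)
    inj′ : ∀ a b → colour′ a ≡ colour′ b → a ≡ b
    inj′ zero    zero    eq = refl
    inj′ zero    (suc b) eq = contradiction (b , eq) new
    inj′ (suc a) zero    eq = contradiction (a , sym eq) new
    inj′ (suc a) (suc b) eq = cong suc (colour-inj F eq)
    -- The new line moves only along `σ` and keeps the old focus fixed; each old line moves together
    -- with `σ`, its wildcards taking the same letter.
    tail : Fin (suc s) → Pattern (suc r) l
    tail = snoc (constant (point F)) (proj₁ ∘ line F)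
    tail-mono : ∀ a → Mono (toℕ i) (λ w → f (σ [ zero ] ++ w)) (tail a) (colour′ a)
    tail-mono zero    i′ i′< = cong (λ w → f (σ [ zero ] ++ w)) (constant-[] (point F) i′)
    tail-mono (suc a) i′ i′< = line-mono F a i′ i′<
    tail-focus : ∀ a → tail a [ i ] ≡ point F
    tail-focus zero    = constant-[] (point F) i
    tail-focus (suc a) = line-focus F a

  -- Induction on `s`. The suffix length `l` is fixed first, and the prefixes then need a line for
  -- `k ^ (suc r ^ l)` colours; hence `below` has to cover every number of colours.
  focusing : ∀ {k} i → (∀ k′ → HalesJewettBelow (toℕ i) k′) →
             ∀ s → ∃ λ l → (f : Word (suc r) l → Fin k) → MonoOrFocused s i f
  -- With no lines to focus, the empty word serves as the focus.
  focusing i below zero = 0 , λ f → inj₂ record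
    { point = [] ; colour = λ () ; colour-inj = λ {} ; line = λ () ; line-mono = λ () ; line-focus = λ () }
  focusing {k} i below (suc s) with focusing {k} i below s
  ... | l , hyp with below (k ^ (suc r ^ l))
  ... | m , hj = m + l , step
    where
    step : ∀ f → MonoOrFocused (suc s) i f
    step f with hj (suffixColouring f)
    ... | σ , mono with hyp (λ w → f (proj₁ σ [ zero ] ++ w))
    ... | inj₁ monoLine = inj₁ (prepend f (proj₁ σ [ zero ]) monoLine)
    ... | inj₂ F        = refocus i f σ mono F

  -- Focusing at the letter `j` with `suc k` lines must yield the monochromatic line, since `k`
  -- colours cannot give `suc k` distinct ones.
  halesJewettBelow : ∀ j → j ≤ suc r → ∀ k → HalesJewettBelow j k
  -- Nothing is constrained, but a line needs a wildcard, so the length is 1.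
  halesJewettBelow zero    _   k = 1 , λ f → (nothing ∷ [] , here refl) , λ i ()
  halesJewettBelow (suc j) j<r k
    with l , hyp ← focusing {k} (fromℕ< j<r)
           (λ k′ → subst (λ j → HalesJewettBelow j k′) (sym (toℕ-fromℕ< j<r))
                         (halesJewettBelow j (ℕ.<⇒≤ j<r) k′))
           (suc k)
    = l , λ f → subst (λ j → MonoLine (suc j) f) (toℕ-fromℕ< j<r)
        ([ id , (λ F → ⊥-elim (<⇒notInjective (ℕ.n<1+n k) (colour-inj F))) ]′ (hyp f))

abstract
  halesJewett : ∀ r k → ∃ λ l → (f : Word (suc r) l → Fin k) →
                ∃ λ ((τ , _) : Line l) → ∀ i → f (τ [ i ]) ≡ f (τ [ zero ])
  halesJewett r k with halesJewettBelow {r} (suc r) ℕ.≤-refl k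
  ... | l , hj = l , λ f → let (τ , mono) = hj f in τ , λ i → mono i (toℕ<n i)

-- The grid digraphs

δ : Fin 4 → Fin 4 → ℕ
δ i c = if does (i ≟ c) then 1 else 0

δ-refl : ∀ i → δ i i ≡ 1
δ-refl i rewrite dec-true (i ≟ i) refl = refl

δ-≢ : ∀ {i c} → i ≢ c → δ i c ≡ 0
δ-≢ {i} {c} i≢c rewrite dec-false (i ≟ c) i≢c = refl

next-≢ : ∀ (i : Fin 4) → next i ≢ i
next-≢ = from-yes (all? {4} (λ i → ¬? (next i ≟ i)))

next-injective : ∀ (i j : Fin 4) → next i ≡ next j → i ≡ j
next-injective = from-yes (all? {4} (λ i → all? (λ j → (next i ≟ next j) →-dec (i ≟ j))))

avoid : ∀ (i j k : Fin 4) → ∃ λ m → i ≢ m × j ≢ m × k ≢ m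
avoid = from-yes (all? {4} λ i → all? {4} λ j → all? {4} λ k → any? {4} λ m →
  ¬? (i ≟ m) ×-dec ¬? (j ≟ m) ×-dec ¬? (k ≟ m))

Point : Set
Point = Fin 4 → ℕ

-- Says that `y − x` is an integer multiple of `e_{i+1} − e_i`, without subtraction.
Collinear : Fin 4 → Point → Point → Set
Collinear i x y = x i + x (next i) ≡ y i + y (next i) × (∀ c → c ≢ i → c ≢ next i → x c ≡ y c)

collinear-sym : ∀ {i} x y → Collinear i x y → Collinear i y x
collinear-sym x y (e , f) = sym e , λ c p q → sym (f c p q)

collinear-trans : ∀ {i} x y z → Collinear i x y → Collinear i y z → Collinear i x z
collinear-trans x y z (e , f) (e′ , f′) = trans e e′ , λ c p q → trans (f c p q) (f′ c p q)

collinear⇒≗ : ∀ {i} x y → Collinear i x y → x i ≡ y i → x ≗ y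
collinear⇒≗ {i} x y (e , f) xᵢ≡yᵢ c with c ≟ i | c ≟ next i
... | yes refl | _        = xᵢ≡yᵢ
... | no _     | yes refl = ℕ.+-cancelˡ-≡ (x i) _ _ (trans e (cong (_+ y (next i)) (sym xᵢ≡yᵢ)))
... | no c≢i   | no c≢i′  = f c c≢i c≢i′

record Step (i : Fin 4) (x y : Point) : Set where
  constructor step
  field
    collinear : Collinear i x y
    descends  : y i < x i
open Step

Step? : ∀ i x y → Dec (Step i x y)
Step? i x y = map′ (λ (c , d) → step c d) (λ s → collinear s , descends s)
  (((x i + x (next i) ℕ.≟ y i + y (next i)) ×-dec
    all? (λ c → ¬? (c ≟ i) →-dec ¬? (c ≟ next i) →-dec (x c ℕ.≟ y c))) ×-dec (y i ℕ.<? x i))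

-- Shift φ x y says that y = x + Σᵢ φ(i) (e_{i+1} − e_i), without subtraction.
record Shift (φ x y : Point) : Set where
  constructor shift
  field
    balance : ∀ c → y (next c) + φ (next c) ≡ x (next c) + φ c
open Shift

shift-trans : ∀ {φ ψ x y z} → Shift φ x y → Shift ψ y z → Shift (λ c → φ c + ψ c) x z
shift-trans {φ} {ψ} {x} {y} {z} s s′ = shift λ c → let c′ = next c in ℕ.+-cancelˡ-≡ (y c′) _ _ (begin
  y c′ + (z c′ + (φ c′ + ψ c′))   ≡⟨ shuffle₁ (y c′) (z c′) (φ c′) (ψ c′) ⟩
  (y c′ + φ c′) + (z c′ + ψ c′)   ≡⟨ cong₂ _+_ (balance s c) (balance s′ c) ⟩
  (x c′ + φ c) + (y c′ + ψ c)     ≡⟨ shuffle₂ (x c′) (y c′) (φ c) (ψ c) ⟩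
  y c′ + (x c′ + (φ c + ψ c))     ∎)
  where
  open ≡-Reasoning
  shuffle₁ : ∀ a b p q → a + (b + (p + q)) ≡ (a + p) + (b + q)
  shuffle₁ = solve-∀
  shuffle₂ : ∀ a b p q → (a + p) + (b + q) ≡ b + (a + (p + q))
  shuffle₂ = solve-∀

step⇒shift : ∀ {i x y} → Step i x y → ∃ λ t → 0 < t × Shift (λ c → t * δ i c) x y
step⇒shift {i} {x} {y} (step (e , f) y<x) = t , ℕ.m<n⇒0<n∸m y<x , shift balanced
  where
  t = x i ∸ y i
  yᵢ+t≡xᵢ : y i + t ≡ x i
  yᵢ+t≡xᵢ = ℕ.m+[n∸m]≡n (ℕ.<⇒≤ y<x)
  balanced : ∀ c → y (next c) + t * δ i (next c) ≡ x (next c) + t * δ i c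
  -- Coordinate `next c` gains `t` if `c` is `i`, loses `t` if `next c` is `i`, and is otherwise
  -- unchanged.
  balanced c with c ≟ i | next c ≟ i
  ... | yes refl | _
    rewrite δ-refl i | δ-≢ (next-≢ i ∘ sym) | ℕ.*-identityʳ t | ℕ.*-zeroʳ t | ℕ.+-identityʳ (y (next i)) =
      ℕ.+-cancelˡ-≡ (y i) _ _ (trans (sym e) (trans (cong (_+ x (next i)) (sym yᵢ+t≡xᵢ)) (swapped (y i) t (x (next i)))))
    where
    swapped : ∀ a b c → (a + b) + c ≡ a + (c + b)
    swapped = solve-∀
  ... | no c≢i | yes refl
    rewrite δ-refl (next c) | δ-≢ (next-≢ c) | ℕ.*-identityʳ t | ℕ.*-zeroʳ t | ℕ.+-identityʳ (x (next c)) = yᵢ+t≡xᵢ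
  ... | no c≢i | no c′≢i
    rewrite δ-≢ (c≢i ∘ sym) | δ-≢ (c′≢i ∘ sym) | ℕ.*-zeroʳ t =
      cong (_+ 0) (sym (f (next c) c′≢i (c≢i ∘ next-injective c i)))

-- The four vectors e_{i+1} − e_i satisfy no linear relation other than the multiples of "their sum is 0".
closed-shift : ∀ {φ x} → Shift φ x x → ∀ {m} → φ m ≡ 0 → ∀ c → φ c ≡ 0
closed-shift {φ} {x} s {m} φm≡0 c = trans (const c) (trans (sym (const m)) φm≡0)
  where
  inv : ∀ c → φ (next c) ≡ φ c
  inv c = ℕ.+-cancelˡ-≡ (x (next c)) _ _ (balance s c)
  const : ∀ c → φ c ≡ φ zero
  const zero                   = refl
  const (suc zero)             = inv zero
  const (suc (suc zero))       = trans (inv (suc zero)) (inv zero)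
  const (suc (suc (suc zero))) = trans (inv (suc (suc zero))) (trans (inv (suc zero)) (inv zero))

no-step-triangle : ∀ {i j k x y z} → Step i x y → Step j y z → Step k z x → ⊥
no-step-triangle {i} {j} {k} {x} {y} {z} p q r
  with t , 0<t , s ← step⇒shift p | t′ , _ , s′ ← step⇒shift q | t″ , _ , s″ ← step⇒shift r
     | m , i≢m , j≢m , k≢m ← avoid i j k
  = ℕ.<⇒≢ 0<t (sym (trans (sym (trans (cong (t *_) (δ-refl i)) (ℕ.*-identityʳ t)))
      (ℕ.m+n≡0⇒m≡0 _ (ℕ.m+n≡0⇒m≡0 _ (closed-shift (shift-trans (shift-trans s s′) s″) {m} φm≡0 i)))))
  where
  φm≡0 : t * δ i m + t′ * δ j m + t″ * δ k m ≡ 0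
  φm≡0 rewrite δ-≢ i≢m | δ-≢ j≢m | δ-≢ k≢m | ℕ.*-zeroʳ t | ℕ.*-zeroʳ t′ | ℕ.*-zeroʳ t″ = refl

no-step-digon : ∀ {i j x y} → Step i x y → Step j y x → ⊥
no-step-digon {i} {j} {x} {y} p q
  with t , 0<t , s ← step⇒shift p | t′ , _ , s′ ← step⇒shift q
     | m , i≢m , j≢m , _ ← avoid i j j
  = ℕ.<⇒≢ 0<t (sym (trans (sym (trans (cong (t *_) (δ-refl i)) (ℕ.*-identityʳ t)))
      (ℕ.m+n≡0⇒m≡0 _ (closed-shift (shift-trans s s′) {m} φm≡0 i))))
  where
  φm≡0 : t * δ i m + t′ * δ j m ≡ 0
  φm≡0 rewrite δ-≢ i≢m | δ-≢ j≢m | ℕ.*-zeroʳ t | ℕ.*-zeroʳ t′ = refl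

-- Points as vertices, steps as arcs

funToFin-cong : ∀ {a b} {f g : Fin a → Fin b} → f ≗ g → funToFin f ≡ funToFin g
funToFin-cong {zero}  f≗g = refl
funToFin-cong {suc a} f≗g = cong₂ combine (f≗g zero) (funToFin-cong (f≗g ∘ suc))

coord : ∀ N → Fin (N ^ 4) → Point
coord N v c = toℕ (finToFun {N} {4} v c)

coord-injective : ∀ N v w → coord N v ≗ coord N w → v ≡ w
coord-injective N v w v≗w = trans (sym (funToFin-finToFin {4} {N} v))
  (trans (funToFin-cong {4} {N} (λ c → toℕ-injective (v≗w c))) (funToFin-finToFin {4} {N} w))

does-true : ∀ {A : Set} (a? : Dec A) → does a? ≡ true → A
does-true (yes a) _ = a

arc? : ∀ N v w → Dec (∃ λ i → Step i (coord N v) (coord N w))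
arc? N v w = any? (λ i → Step? i (coord N v) (coord N w))

grid : ℕ → Digraph
grid N = record
  { n        = N ^ 4
  ; arc      = λ v w → does (arc? N v w)
  -- A loop is a degenerate digon.
  ; loopless = λ v → dec-false (arc? N v v) (λ (_ , s) → no-step-digon s s)
  ; oriented = λ v w vw → dec-false (arc? N w v) (λ (_ , s) → no-step-digon (proj₂ (does-true (arc? N v w) vw)) s)
  }

arc⇒step : ∀ N {v w} → arc (grid N) v w ≡ true → ∃ λ i → Step i (coord N v) (coord N w)
arc⇒step N {v} {w} = does-true (arc? N v w)

step⇒arc : ∀ N {v w i} → Step i (coord N v) (coord N w) → arc (grid N) v w ≡ true
step⇒arc N {v} {w} {i} s = dec-true (arc? N v w) (i , s)

TriangleFree : Digraph → Set
TriangleFree D = ∀ u v w → arc D u v ≡ true → arc D v w ≡ true → arc D w u ≡ true → ⊥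

grid-triangleFree : ∀ N → TriangleFree (grid N)
grid-triangleFree N _ _ _ uv vw wu = no-step-triangle
  (proj₂ (arc⇒step N uv)) (proj₂ (arc⇒step N vw)) (proj₂ (arc⇒step N wu))

adjacent⇒collinear : ∀ N {u v} → Adjacent (grid N) u v → ∃ λ i → Collinear i (coord N u) (coord N v)
adjacent⇒collinear N {u} {v} (inj₁ uv) with i , s ← arc⇒step N uv = i , collinear s
adjacent⇒collinear N {u} {v} (inj₂ vu) with i , s ← arc⇒step N vu =
  i , collinear-sym (coord N v) (coord N u) (collinear s)

-- Distinct points of a line differ in coordinate `i`, and the order of these coordinates decides
-- the orientation of the arc.
collinear⇒adjacent : ∀ N {v w i} → Collinear i (coord N v) (coord N w) → v ≢ w → Adjacent (grid N) v w
collinear⇒adjacent N {v} {w} {i} col v≢w with ℕ.<-cmp (coord N v i) (coord N w i)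
... | tri< v<w _ _ = inj₂ (step⇒arc N (step (collinear-sym (coord N v) (coord N w) col) v<w))
... | tri≈ _ v≡w _ = contradiction (coord-injective N v w (collinear⇒≗ (coord N v) (coord N w) col v≡w)) v≢w
... | tri> _ _ w<v = inj₁ (step⇒arc N (step col w<v))

-- Both `v` and `w` lie on the line through `u` in the common direction.
grid-neighbours : ∀ N {u v w} (p : Adjacent (grid N) u v) (q : Adjacent (grid N) u w) →
                  proj₁ (adjacent⇒collinear N p) ≡ proj₁ (adjacent⇒collinear N q) →
                  v ≢ w → Adjacent (grid N) v w
grid-neighbours N {u} {v} {w} p q eq with adjacent⇒collinear N p | adjacent⇒collinear N q | eq
... | i , col | .i , col′ | refl = collinear⇒adjacent N
  (collinear-trans (coord N v) (coord N u) (coord N w) (collinear-sym (coord N u) (coord N v) col) col′)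

-- Monochromatic directed 4-cycles in the grid digraphs

occ : ∀ {l} → Word 4 l → Point
occ []      c = 0
occ (i ∷ w) c = δ i c + occ w c

fixedOcc : ∀ {l} → Pattern 4 l → Point
fixedOcc []            c = 0
fixedOcc (just i  ∷ τ) c = δ i c + fixedOcc τ c
fixedOcc (nothing ∷ τ) c = fixedOcc τ c

wildcards : ∀ {l} → Pattern 4 l → ℕ
wildcards []            = 0
wildcards (just _  ∷ τ) = wildcards τ
wildcards (nothing ∷ τ) = suc (wildcards τ)

wildcards>0 : ∀ {l} {τ : Pattern 4 l} → nothing ∈ τ → 0 < wildcards τ
wildcards>0                   (here refl) = z<s
wildcards>0 {τ = just _  ∷ τ} (there τ∋)  = wildcards>0 τ∋
wildcards>0 {τ = nothing ∷ τ} (there τ∋)  = z<s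

δ≤1 : ∀ i c → δ i c ≤ 1
δ≤1 i c with does (i ≟ c)
... | true  = s≤s z≤n
... | false = z≤n

occ≤length : ∀ {l} (w : Word 4 l) c → occ w c ≤ l
occ≤length []      c = z≤n
occ≤length (i ∷ w) c = ℕ.+-mono-≤ (δ≤1 i c) (occ≤length w c)

occ-[] : ∀ {l} (τ : Pattern 4 l) i c → occ (τ [ i ]) c ≡ fixedOcc τ c + wildcards τ * δ i c
occ-[] []            i c = refl
occ-[] (just j  ∷ τ) i c rewrite occ-[] τ i c = sym (ℕ.+-assoc (δ j c) (fixedOcc τ c) _)
occ-[] (nothing ∷ τ) i c rewrite occ-[] τ i c = swap-summands (δ i c) (fixedOcc τ c) _
  where
  swap-summands : ∀ a b d → a + (b + d) ≡ b + (a + d)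
  swap-summands = solve-∀

-- Letter counts of a word of length `l` range over `0, …, l`, so a grid of side `suc l` holds them.
boundedOcc : ∀ {l} → Word 4 l → Fin 4 → Fin (suc l)
boundedOcc w c = fromℕ< (s≤s (occ≤length w c))

vertex : ∀ {l} → Word 4 l → Fin (suc l ^ 4)
vertex w = funToFin (boundedOcc w)

coord-vertex : ∀ {l} (w : Word 4 l) → coord (suc l) (vertex w) ≗ occ w
coord-vertex w c = trans (cong toℕ (finToFun-funToFin (boundedOcc w) c)) (toℕ-fromℕ< (s≤s (occ≤length w c)))

translate-step : ∀ {F : Point} {t x y} i → 0 < t →
                 (∀ c → x c ≡ F c + t * δ i c) → (∀ c → y c ≡ F c + t * δ (next i) c) → Step i x y
translate-step {F} {t} {x} {y} i 0<t x≡ y≡ = step (sums , others) descent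
  where
  sums : x i + x (next i) ≡ y i + y (next i)
  sums rewrite x≡ i | x≡ (next i) | y≡ i | y≡ (next i) | δ-refl i | δ-refl (next i)
             | δ-≢ (next-≢ i) | δ-≢ (next-≢ i ∘ sym) = regroup (F i) (F (next i)) t
    where
    regroup : ∀ a b t → (a + t * 1) + (b + t * 0) ≡ (a + t * 0) + (b + t * 1)
    regroup = solve-∀
  others : ∀ c → c ≢ i → c ≢ next i → x c ≡ y c
  others c c≢i c≢i′ rewrite x≡ c | y≡ c | δ-≢ (c≢i ∘ sym) | δ-≢ (c≢i′ ∘ sym) = refl
  descent : y i < x i
  descent rewrite x≡ i | y≡ i | δ-refl i | δ-≢ (next-≢ i) | ℕ.*-zeroʳ t | ℕ.*-identityʳ t =
    ℕ.+-monoʳ-< (F i) 0<t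

-- Passing from letter `i` to `next i` moves `wildcards τ` units from coordinate `i` to the next
-- one, a step in direction `i`. The index 2 stands for length 4.
lineCycle : ∀ {l} (τ : Pattern 4 l) → nothing ∈ τ → DirectedCycle (grid (suc l)) 2
lineCycle {l} τ τ∋ = record
  { vert = λ i → vertex (τ [ i ])
  ; inj  = λ {i} {j} → injective i j
  ; arcs = λ i → step⇒arc (suc l) (translate-step i (wildcards>0 τ∋) (coords i) (coords (next i)))
  }
  where
  coords : ∀ i c → coord (suc l) (vertex (τ [ i ])) c ≡ fixedOcc τ c + wildcards τ * δ i c
  coords i c = trans (coord-vertex (τ [ i ]) c) (occ-[] τ i c)
  injective : ∀ i j → vertex (τ [ i ]) ≡ vertex (τ [ j ]) → i ≡ j
  injective i j eq with i ≟ j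
  ... | yes i≡j = i≡j
  ... | no  i≢j = contradiction (sym (begin
    wildcards τ           ≡⟨ ℕ.*-identityʳ _ ⟨
    wildcards τ * 1       ≡⟨ cong (wildcards τ *_) (δ-refl i) ⟨
    wildcards τ * δ i i   ≡⟨ ℕ.+-cancelˡ-≡ (fixedOcc τ i) _ _
                              (trans (sym (coords i i)) (trans (cong (λ v → coord (suc l) v i) eq) (coords j i))) ⟩
    wildcards τ * δ j i   ≡⟨ cong (wildcards τ *_) (δ-≢ (i≢j ∘ sym)) ⟩
    wildcards τ * 0       ≡⟨ ℕ.*-zeroʳ (wildcards τ) ⟩
    0                     ∎)) (ℕ.<⇒≢ (wildcards>0 τ∋))
    where open ≡-Reasoning

grid-monochromatic-cycle : ∀ k → ∃ λ N → ∀ (f : Fin (N ^ 4) → Fin k) →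
                           ∃ λ (C : DirectedCycle (grid N) 2) → ∀ i → f (vert C i) ≡ f (vert C zero)
grid-monochromatic-cycle k = suc l , λ f → let L = proj₁ (hj (f ∘ vertex)) in
  lineCycle (proj₁ L) (proj₂ L) , proj₂ (hj (f ∘ vertex))
  where
  -- The alphabet has `suc 3` letters, one for each coordinate.
  l  = proj₁ (halesJewett 3 k)
  hj = proj₂ (halesJewett 3 k)

-- Forbidden subdigraphs

-- Existing arcs are kept, so directed cycles survive; every other pair is oriented by the order of
-- the vertices.
complete : Digraph → Digraph
complete D = record
  { n        = n D
  ; arc      = λ u v → arc D u v ∨ (not (arc D v u) ∧ does (u <? v))
  ; loopless = λ v → irreflexive (arc D v v) (loopless D v) (dec-false (v <? v) (<-irrefl refl))
  ; oriented = λ u v → asymmetric (arc D u v) (arc D v u) (does (u <? v)) (oriented D u v)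
      (λ u<v → dec-false (v <? u) (<-asym (does-true (u <? v) u<v)))
  }
  where
  irreflexive : ∀ a {p} → a ≡ false → p ≡ false → a ∨ (not a ∧ p) ≡ false
  irreflexive false _ p≡false = p≡false
  asymmetric : ∀ a b p {q} → (a ≡ true → b ≡ false) → (p ≡ true → q ≡ false) →
               a ∨ (not b ∧ p) ≡ true → b ∨ (not a ∧ q) ≡ false
  asymmetric true  b     p    h _ _ rewrite h refl = refl
  asymmetric false false true _ h _ = h refl

complete-arc : ∀ D {u v} → arc D u v ≡ true → arc (complete D) u v ≡ true
complete-arc D uv rewrite uv = refl

complete-isTournament : ∀ D → IsTournament (complete D)
complete-isTournament D u v u≢v with arc D u v in uv | arc D v u in vu | <-cmp u v
... | true  | _     | _            = inj₁ refl
... | false | true  | _            = inj₂ refl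
... | false | false | tri< u<v _ _ = inj₁ (dec-true (u <? v) u<v)
... | false | false | tri≈ _ u≡v _ = contradiction u≡v u≢v
... | false | false | tri> _ _ v<u = inj₂ (dec-true (v <? u) v<u)

complete-cycle : ∀ D {k} → DirectedCycle D k → DirectedCycle (complete D) k
complete-cycle D C = record { vert = vert C ; inj = inj C ; arcs = λ i → complete-arc D (arcs C i) }

copy-adjacent⁺ : ∀ {H D} (φ : InducedCopy H D) {u v} → Adjacent H u v → Adjacent D (emb φ u) (emb φ v)
copy-adjacent⁺ φ (inj₁ uv) = inj₁ (trans (pres φ _ _) uv)
copy-adjacent⁺ φ (inj₂ vu) = inj₂ (trans (pres φ _ _) vu)

copy-adjacent⁻ : ∀ {H D} (φ : InducedCopy H D) {u v} → Adjacent D (emb φ u) (emb φ v) → Adjacent H u v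
copy-adjacent⁻ φ (inj₁ uv) = inj₁ (trans (sym (pres φ _ _)) uv)
copy-adjacent⁻ φ (inj₂ vu) = inj₂ (trans (sym (pres φ _ _)) vu)

copy-triangleFree : ∀ {H D} → InducedCopy H D → TriangleFree D → TriangleFree H
copy-triangleFree φ triangleFree u v w uv vw wu = triangleFree (emb φ u) (emb φ v) (emb φ w)
  (trans (pres φ u v) uv) (trans (pres φ v w) vw) (trans (pres φ w u) wu)

leaves : ∀ {m t} → m ≡ suc t → (centre : Fin m) →
         ∃ λ (leaf : Fin t → Fin m) → Injective _≡_ _≡_ leaf × (∀ a → leaf a ≢ centre)
leaves refl centre = punchIn centre , punchIn-injective centre _ _ , punchInᵢ≢i centre

-- Two of the `t` leaves fall into the same one of `d < t` classes and are thus adjacent, but leaves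
-- of a star are not. As `clique` acts on adjacency proofs, it may depend on the proof chosen.
clique-cover⇒star-free : ∀ {D F d t} → d < t → IsOrientedStar F t →
  (clique : ∀ {u v} → Adjacent D u v → Fin d) →
  (∀ {u v w} (p : Adjacent D u v) (q : Adjacent D u w) → clique p ≡ clique q → v ≢ w → Adjacent D v w) →
  Free F D
clique-cover⇒star-free {D} {F} d<t star clique covers φ
  with leaf , leaf-inj , leaf-≢ ← leaves (IsOrientedStar.size star) (IsOrientedStar.centre star)
  with a , b , a<b , eq ← pigeonhole d<t
         (λ a → clique (copy-adjacent⁺ φ (IsOrientedStar.spokes star (leaf a) (leaf-≢ a))))
  with copy-adjacent⁻ φ (covers _ _ eq (<⇒≢ a<b ∘ leaf-inj ∘ injEmb φ))
... | inj₁ ab = contradiction (trans (sym ab) (IsOrientedStar.noLeafArc star _ _ (leaf-≢ a) (leaf-≢ b))) λ ()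
... | inj₂ ba = contradiction (trans (sym ba) (IsOrientedStar.noLeafArc star _ _ (leaf-≢ b) (leaf-≢ a))) λ ()

grid-star-free : ∀ N {F t} → 5 ≤ t → IsOrientedStar F t → Free F (grid N)
grid-star-free N 5≤t star = clique-cover⇒star-free 5≤t star
  (λ {u} {v} p → proj₁ (adjacent⇒collinear N {u} {v} p)) (λ {u} {v} {w} → grid-neighbours N {u} {v} {w})

-- Tournaments without directed triangles, and the conclusion

next-inject₁ : ∀ {m} (i : Fin m) → next (inject₁ i) ≡ suc i
next-inject₁ {suc m} zero = refl
next-inject₁ {suc m} (suc i) rewrite next-inject₁ i = refl

next-fromℕ : ∀ m → next (fromℕ m) ≡ zero
next-fromℕ zero = refl
next-fromℕ (suc m) rewrite next-fromℕ m = refl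

-- Along the cycle, the initial vertex has an arc to each later one: an arc back from the next
-- vertex would close a triangle. At the last vertex this contradicts the closing arc.
triangleFree-tournament⇒acyclic : ∀ {D} → IsTournament D → TriangleFree D → Acyclic D
triangleFree-tournament⇒acyclic {D} tournament triangleFree k C with reach (fromℕ (suc k))
  where
  reach : ∀ i → i ≡ zero ⊎ arc D (vert C zero) (vert C i) ≡ true
  reach = <-weakInduction _ (inj₁ refl) extend
    where
    extend : ∀ i → inject₁ i ≡ zero ⊎ arc D (vert C zero) (vert C (inject₁ i)) ≡ true →
             suc i ≡ zero ⊎ arc D (vert C zero) (vert C (suc i)) ≡ true
    extend i h with subst (λ j → arc D (vert C (inject₁ i)) (vert C j) ≡ true) (next-inject₁ i) (arcs C (inject₁ i))
    extend i (inj₁ i≡0) | a = inj₂ (subst (λ j → arc D (vert C j) (vert C (suc i)) ≡ true) i≡0 a)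
    extend i (inj₂ b)   | a with tournament (vert C zero) (vert C (suc i)) (λ eq → contradiction (inj C eq) λ ())
    ... | inj₁ c = inj₂ c
    ... | inj₂ c = ⊥-elim (triangleFree _ _ _ b a c)
... | inj₂ a = contradiction (trans (sym (oriented D _ _ a))
  (subst (λ j → arc D (vert C (fromℕ (suc k))) (vert C j) ≡ true) (next-fromℕ (suc k)) (arcs C (fromℕ (suc k))))) λ ()

theorem1p5 : (F H : Digraph) (t : ℕ) → 5 ≤ t → IsOrientedStar F t →
    ChiFinite₂ H F → IsTransitiveTournament H
theorem1p5 F H t 5≤t star (c , dicolour) = tournament , acyclic
  where
  -- A single grid, chosen for the bound `c`, serves both halves.
  uncolourable : ∃ λ N → ∀ f → ∃ λ (C : DirectedCycle (grid N) 2) → ∀ i → f (vert C i) ≡ f (vert C zero)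
  uncolourable = grid-monochromatic-cycle c
  N : ℕ
  N = proj₁ uncolourable

  tournament : IsTournament H
  tournament u v u≢v with (arc H u v Bool.≟ true) ⊎-dec (arc H v u Bool.≟ true)
  ... | yes uv  = uv
  ... | no  ¬uv = ⊥-elim (proper 2 (complete-cycle (grid N) C) mono)
    where
    T : Digraph
    T = complete (grid N)
    H-free : Free H T
    H-free φ = ¬uv (copy-adjacent⁻ φ (complete-isTournament (grid N) _ _ (u≢v ∘ injEmb φ)))
    F-free : Free F T
    -- In a tournament every neighbourhood is a single clique.
    F-free = clique-cover⇒star-free {d = 1} (ℕ.≤-trans (s≤s (s≤s z≤n)) 5≤t) star
      (λ _ → zero) (λ _ _ _ → complete-isTournament (grid N) _ _)
    colouring : Dicolourable T c
    colouring = dicolour T H-free F-free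
    proper = proj₂ colouring
    C = proj₁ (proj₂ uncolourable (proj₁ colouring))
    mono = proj₂ (proj₂ uncolourable (proj₁ colouring))

  acyclic : Acyclic H
  acyclic k cycle = proper 2 C mono
    where
    H-free : Free H (grid N)
    -- A tournament inside the grid inherits triangle-freeness and would be acyclic, against
    -- `cycle`.
    H-free φ = triangleFree-tournament⇒acyclic tournament (copy-triangleFree φ (grid-triangleFree N)) k cycle
    colouring : Dicolourable (grid N) c
    colouring = dicolour (grid N) H-free (grid-star-free N 5≤t star)
    proper = proj₂ colouring
    C = proj₁ (proj₂ uncolourable (proj₁ colouring))
    mono = proj₂ (proj₂ uncolourable (proj₁ colouring))
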